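{- Let $G$ be a finite simple graph, let $H$ be an induced subgraph of $G$ and let $B\subseteq V(H)$. Then $$\zeta_H(B)\le \zeta_G(B).$$
   Context: For a finite simple graph $G$ and a subset $B\subseteq V(G)$, the $B$-restricted clique polynomial is $C_B(G;x)=\sum_{i=0}^{\omega(G[B])} c_i(B)x^i$, where $c_i(B)$ is the number of subsets $K\subseteq B$ with $|K|=i$ that are cliques in $G$; the empty set counts as a clique, so $c_0(B)=1$. Let $Z_B(G)=\{x<0 : C_B(G;x)=0\}$ (real $x$). If $Z_B(G)\neq\emptyset$, define $\zeta_G(B)=\max Z_B(G)$, the largest negative root of $C_B(G;x)$; if $Z_B(G)=\emptyset$, set $\zeta_G(B)=-\infty$. -}

module Defs where

open import Axiom.ExcludedMiddle using (ExcludedMiddle)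
open import Data.Fin using (Fin)
open import Data.Fin.Properties using (all?) renaming (_≟_ to _≟ᶠ_)
open import Data.Fin.Subset using (Subset; inside; outside; _∈_; _⊆_; _∩_; ∣_∣; ⊥)
open import Data.Fin.Subset.Properties using (_∈?_; _⊆?_; ∉⊥; ∣⊥∣≡0; x∈p∩q⁺)
open import Data.Integer using (+_)
open import Data.List using (List; []; _∷_; _++_; map; filter; length; foldr; upTo; applyUpTo)
open import Data.List.Membership.Propositional using () renaming (_∈_ to _∈ˡ_)
open import Data.List.Membership.Propositional.Properties using (∈-filter⁺; ∈-map⁺; ∈-++⁺ʳ)
open import Data.List.Relation.Unary.Any using (here)
open import Data.Nat as ℕ using (ℕ; zero; suc)
import Data.Nat.Properties as ℕ
open import Data.Product using (∃; _×_; _,_; proj₁; proj₂)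
open import Data.Rational
  using (ℚ; 0ℚ; 1ℚ; ½; _⊓_; _+_; _*_; _-_; -_; _<_; _≤_; 1/_; positive; nonNegative)
  renaming (∣_∣ to abs; _/_ to _÷_)
open import Data.Rational.Properties
  using (module ≤-Reasoning; _<?_; ≤-refl; ≤-trans; <-irrefl; <⇒≤; ≮⇒≥; <-≤-trans; ≤-<-trans;
         ∣p+q∣≤∣p∣+∣q∣; ∣p*q∣≡∣p∣*∣q∣; 0≤∣p∣; 0≤p⇒∣p∣≡p; ∣-p∣≡∣p∣;
         +-identityʳ; +-inverseʳ; +-mono-<; +-monoˡ-<; +-monoˡ-≤; +-monoʳ-<; +-monoʳ-≤;
         *-zeroˡ; *-identityʳ; *-inverseʳ; *-monoʳ-<-pos; *-monoʳ-≤-nonNeg; *-monoˡ-≤-nonNeg;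
         positive⁻¹; pos*pos⇒pos; 1/pos⇒pos; pos⇒nonZero; normalize-pos; ⊓-sel; p⊓q≤p; p⊓q≤q)
open import Data.Rational.Solver using (module +-*-Solver)
open import Data.Sum using (_⊎_; inj₁; inj₂; [_,_]′)
import Data.Vec
open import Function using (_⇔_)
open import Level using (0ℓ)
open import Relation.Binary.PropositionalEquality using (_≡_; _≢_; refl; sym; trans; cong; subst; module ≡-Reasoning)
open import Relation.Nullary using (¬_; Dec; yes; no; contradiction)
open import Relation.Nullary.Construct.Add.Infimum using (_₋; ⊥₋; [_])
open import Relation.Nullary.Decidable using (_→-dec_; _×-dec_; ¬?)

Eventually : (ℕ → Set) → Set
Eventually P = ∃ λ N → ∀ n → N ℕ.≤ n → P n

Cauchy : (ℕ → ℚ) → Set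
Cauchy x = ∀ ε → 0ℚ < ε → ∃ λ N → ∀ m n → N ℕ.≤ m → N ℕ.≤ n → abs (x m - x n) < ε

-- The real numbers are Cauchy sequences of rationals; equality of reals is _≈ᴿ_,
-- not _≡_.
record ℝ : Set where
  constructor mkℝ
  field
    seq    : ℕ → ℚ
    cauchy : Cauchy seq

open ℝ public

infix 4 _≈ᴿ_ _<ᴿ_ _≤ᴿ_

_≈ᴿ_ : ℝ → ℝ → Set
x ≈ᴿ y = ∀ ε → 0ℚ < ε → Eventually λ n → abs (seq x n - seq y n) < ε

_<ᴿ_ : ℝ → ℝ → Set
x <ᴿ y = ∃ λ δ → 0ℚ < δ × Eventually λ n → seq x n + δ ≤ seq y n

_≤ᴿ_ : ℝ → ℝ → Set
x ≤ᴿ y = ¬ (y <ᴿ x)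

open import Relation.Binary.Construct.Add.Infimum.NonStrict _≤ᴿ_ public using (_≤₋_)

Eventually-map : ∀ {P Q} → (∀ n → P n → Q n) → Eventually P → Eventually Q
Eventually-map f (N , h) = N , λ n N≤n → f n (h n N≤n)

Eventually-zip : ∀ {P Q R} → (∀ n → P n → Q n → R n) → Eventually P → Eventually Q → Eventually R
Eventually-zip f (M , g) (N , h) = M ℕ.⊔ N , λ n le →
  f n (g n (ℕ.m⊔n≤o⇒m≤o M N le)) (h n (ℕ.m⊔n≤o⇒n≤o M N le))

Eventually-witness : ∀ {P} → Eventually P → ∃ P
Eventually-witness (N , h) = N , h N ℕ.≤-refl

½+½ : ∀ ε → ½ * ε + ½ * ε ≡ ε
½+½ = solve 1 (λ e → con ½ :* e :+ con ½ :* e := e) refl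
  where open +-*-Solver

*-pos : ∀ {p q} → 0ℚ < p → 0ℚ < q → 0ℚ < p * q
*-pos {p} {q} 0<p 0<q = positive⁻¹ (p * q) {{pos*pos⇒pos p {{positive 0<p}} q {{positive 0<q}}}}

½-pos : ∀ {ε} → 0ℚ < ε → 0ℚ < ½ * ε
½-pos = *-pos (positive⁻¹ ½)

⊓-pos : ∀ {p q} → 0ℚ < p → 0ℚ < q → 0ℚ < p ⊓ q
⊓-pos {p} {q} 0<p 0<q =
  [ (λ p⊓q≡p → subst (0ℚ <_) (sym p⊓q≡p) 0<p) , (λ p⊓q≡q → subst (0ℚ <_) (sym p⊓q≡q) 0<q) ]′ (⊓-sel p q)

p≤abs : ∀ p → p ≤ abs p
p≤abs p with p <? 0ℚ
... | yes p<0 = ≤-trans (<⇒≤ p<0) (0≤∣p∣ p)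
... | no  p≮0 = subst (p ≤_) (sym (0≤p⇒∣p∣≡p (≮⇒≥ p≮0))) ≤-refl

abs-swap : ∀ p q → abs (p - q) ≡ abs (q - p)
abs-swap p q = trans (cong abs (solve 2 (λ a b → a :- b := :- (b :- a)) refl p q)) (∣-p∣≡∣p∣ (q - p))
  where open +-*-Solver

abs-+ : ∀ {p q α β} → abs p < α → abs q < β → abs (p + q) < α + β
abs-+ {p} {q} h k = ≤-<-trans (∣p+q∣≤∣p∣+∣q∣ p q) (+-mono-< h k)

abs-½ : ∀ {p q ε} → abs p < ½ * ε → abs q < ½ * ε → abs (p + q) < ε
abs-½ {p} {q} {ε} h k = subst (abs (p + q) <_) (½+½ ε) (abs-+ {p} {q} h k)

abs-* : ∀ {p q β δ} → 0ℚ < β → abs p < β → abs q < δ → abs (p * q) < β * δ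
abs-* {p} {q} {β} {δ} 0<β h k = begin-strict
  abs (p * q)   ≡⟨ ∣p*q∣≡∣p∣*∣q∣ p q ⟩
  abs p * abs q ≤⟨ *-monoʳ-≤-nonNeg (abs q) {{nonNegative (0≤∣p∣ q)}} (<⇒≤ h) ⟩
  β * abs q     <⟨ *-monoʳ-<-pos β {{positive 0<β}} k ⟩
  β * δ         ∎
  where open ≤-Reasoning

divide : ∀ {β ε} → 0ℚ < β → 0ℚ < ε → ∃ λ δ → 0ℚ < δ × β * δ ≡ ε
divide {β} {ε} 0<β 0<ε = ε * β⁻¹ , *-pos 0<ε (positive⁻¹ β⁻¹ {{1/pos⇒pos β {{positive 0<β}}}}) , eq
  where
  open +-*-Solver
  instance _ = pos⇒nonZero β {{positive 0<β}}
  β⁻¹ = 1/ β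
  eq : β * (ε * β⁻¹) ≡ ε
  eq = trans (solve 3 (λ b e i → b :* (e :* i) := e :* (b :* i)) refl β ε β⁻¹)
             (trans (cong (ε *_) (*-inverseʳ β)) (*-identityʳ ε))

Cauchy⇒bounded : ∀ {x} → Cauchy x → ∃ λ β → 0ℚ < β × Eventually λ n → abs (x n) < β
Cauchy⇒bounded {x} cx with cx 1ℚ (positive⁻¹ 1ℚ)
... | N , h = 1ℚ + abs (x N) , positive-bound , N , bound
  where
  open +-*-Solver
  positive-bound : 0ℚ < 1ℚ + abs (x N)
  positive-bound = <-≤-trans (positive⁻¹ 1ℚ) (+-monoʳ-≤ 1ℚ (0≤∣p∣ (x N)))
  bound : ∀ n → N ℕ.≤ n → abs (x n) < 1ℚ + abs (x N)
  bound n N≤n = subst (λ p → abs p < 1ℚ + abs (x N))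
    (solve 2 (λ a b → (a :- b) :+ b := a) refl (x n) (x N))
    (≤-<-trans (∣p+q∣≤∣p∣+∣q∣ (x n - x N) (x N)) (+-monoˡ-< (abs (x N)) (h n N N≤n ℕ.≤-refl)))

abstract

  +-Cauchy : ∀ {x y} → Cauchy x → Cauchy y → Cauchy λ n → x n + y n
  +-Cauchy {x} {y} cx cy ε 0<ε with cx (½ * ε) (½-pos 0<ε) | cy (½ * ε) (½-pos 0<ε)
  ... | M , g | N , h = M ℕ.⊔ N , λ m n le le′ →
    subst (λ p → abs p < ε)
      (solve 4 (λ a b c d → (a :- b) :+ (c :- d) := (a :+ c) :- (b :+ d)) refl (x m) (x n) (y m) (y n))
      (abs-½ {x m - x n} {y m - y n}
        (g m n (ℕ.m⊔n≤o⇒m≤o M N le) (ℕ.m⊔n≤o⇒m≤o M N le′))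
        (h m n (ℕ.m⊔n≤o⇒n≤o M N le) (ℕ.m⊔n≤o⇒n≤o M N le′)))
    where open +-*-Solver

  difference-* : ∀ a b c d → a * (c - d) + d * (a - b) ≡ a * c - b * d
  difference-* = solve 4 (λ a b c d → a :* (c :- d) :+ d :* (a :- b) := a :* c :- b :* d) refl
    where open +-*-Solver

  *-Cauchy : ∀ {x y} → Cauchy x → Cauchy y → Cauchy λ n → x n * y n
  *-Cauchy {x} {y} cx cy ε 0<ε = bounds (Cauchy⇒bounded cx) (Cauchy⇒bounded cy)
    where
    Goal : Set
    Goal = ∃ λ K → ∀ m n → K ℕ.≤ m → K ℕ.≤ n → abs (x m * y m - x n * y n) < ε

    conclude : ∀ {α β γ δ A B} → 0ℚ < α → (∀ n → A ℕ.≤ n → abs (x n) < α) → 0ℚ < β → (∀ n → B ℕ.≤ n → abs (y n) < β) →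
      α * δ ≡ ½ * ε → β * γ ≡ ½ * ε →
      (∃ λ M → ∀ m n → M ℕ.≤ m → M ℕ.≤ n → abs (x m - x n) < γ) →
      (∃ λ N → ∀ m n → N ℕ.≤ m → N ℕ.≤ n → abs (y m - y n) < δ) → Goal
    conclude {α} {β} {γ} {δ} {A} {B} 0<α x<α 0<β y<β αδ βγ (M , x<γ) (N , y<δ) = (A ℕ.⊔ M) ℕ.⊔ (B ℕ.⊔ N) , λ m n K≤m K≤n →
      let A⊔M≤ : ∀ k → (A ℕ.⊔ M) ℕ.⊔ (B ℕ.⊔ N) ℕ.≤ k → A ℕ.⊔ M ℕ.≤ k
          A⊔M≤ k = ℕ.m⊔n≤o⇒m≤o (A ℕ.⊔ M) (B ℕ.⊔ N)
          B⊔N≤ : ∀ k → (A ℕ.⊔ M) ℕ.⊔ (B ℕ.⊔ N) ℕ.≤ k → B ℕ.⊔ N ℕ.≤ k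
          B⊔N≤ k = ℕ.m⊔n≤o⇒n≤o (A ℕ.⊔ M) (B ℕ.⊔ N)
          first : abs (x m * (y m - y n)) < ½ * ε
          first = subst (abs (x m * (y m - y n)) <_) αδ
            (abs-* {x m} {y m - y n} {α} {δ} 0<α (x<α m (ℕ.m⊔n≤o⇒m≤o A M (A⊔M≤ m K≤m)))
              (y<δ m n (ℕ.m⊔n≤o⇒n≤o B N (B⊔N≤ m K≤m)) (ℕ.m⊔n≤o⇒n≤o B N (B⊔N≤ n K≤n))))
          second : abs (y n * (x m - x n)) < ½ * ε
          second = subst (abs (y n * (x m - x n)) <_) βγ
            (abs-* {y n} {x m - x n} {β} {γ} 0<β (y<β n (ℕ.m⊔n≤o⇒m≤o B N (B⊔N≤ n K≤n)))
              (x<γ m n (ℕ.m⊔n≤o⇒n≤o A M (A⊔M≤ m K≤m)) (ℕ.m⊔n≤o⇒n≤o A M (A⊔M≤ n K≤n))))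
      in subst (λ p → abs p < ε) (difference-* (x m) (x n) (y m) (y n))
           (abs-½ {x m * (y m - y n)} {y n * (x m - x n)} first second)

    moduli : ∀ {α β A B} → 0ℚ < α → (∀ n → A ℕ.≤ n → abs (x n) < α) → 0ℚ < β → (∀ n → B ℕ.≤ n → abs (y n) < β) →
      (∃ λ δ → 0ℚ < δ × α * δ ≡ ½ * ε) → (∃ λ γ → 0ℚ < γ × β * γ ≡ ½ * ε) → Goal
    moduli {α} {β} {A} {B} 0<α x<α 0<β y<β (δ , 0<δ , αδ) (γ , 0<γ , βγ) =
      conclude {α} {β} {γ} {δ} {A} {B} 0<α x<α 0<β y<β αδ βγ (cx γ 0<γ) (cy δ 0<δ)

    bounds : (∃ λ α → 0ℚ < α × Eventually λ n → abs (x n) < α) → (∃ λ β → 0ℚ < β × Eventually λ n → abs (y n) < β) → Goal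
    bounds (α , 0<α , A , x<α) (β , 0<β , B , y<β) =
      moduli {α} {β} {A} {B} 0<α x<α 0<β y<β (divide 0<α (½-pos 0<ε)) (divide 0<β (½-pos 0<ε))

  const-Cauchy : ∀ q → Cauchy λ _ → q
  const-Cauchy q ε 0<ε = 0 , λ _ _ _ _ → subst (λ p → abs p < ε) (sym (+-inverseʳ q)) 0<ε

  neg-Cauchy : ∀ {x} → Cauchy x → Cauchy λ n → - x n
  neg-Cauchy {x} cx ε 0<ε with cx ε 0<ε
  ... | N , h = N , λ m n N≤m N≤n → subst (_< ε)
    (trans (abs-swap (x m) (x n)) (cong abs (solve 2 (λ a b → b :- a := (:- a) :- (:- b)) refl (x m) (x n)))) (h m n N≤m N≤n)
    where open +-*-Solver

infixl 6 _+ᴿ_ _-ᴿ_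
infixl 7 _*ᴿ_

_+ᴿ_ : ℝ → ℝ → ℝ
x +ᴿ y = mkℝ (λ n → seq x n + seq y n) (+-Cauchy {seq x} {seq y} (cauchy x) (cauchy y))

_*ᴿ_ : ℝ → ℝ → ℝ
x *ᴿ y = mkℝ (λ n → seq x n * seq y n) (*-Cauchy {seq x} {seq y} (cauchy x) (cauchy y))

fromℚ : ℚ → ℝ
fromℚ q = mkℝ (λ _ → q) (const-Cauchy q)

fromℕ : ℕ → ℝ
fromℕ k = fromℚ (+ k ÷ 1)

0ᴿ : ℝ
0ᴿ = fromℚ 0ℚ

_-ᴿ_ : ℝ → ℝ → ℝ
x -ᴿ y = mkℝ (λ n → seq x n - seq y n) (+-Cauchy {seq x} {λ n → - seq y n} (cauchy x) (neg-Cauchy {seq y} (cauchy y)))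

Null : (ℕ → ℚ) → Set
Null x = ∀ ε → 0ℚ < ε → Eventually λ n → abs (x n) < ε

p-0≡p : ∀ p → p - 0ℚ ≡ p
p-0≡p = +-identityʳ

Null⇒≈0 : ∀ x → Null (seq x) → x ≈ᴿ 0ᴿ
Null⇒≈0 x null ε 0<ε = Eventually-map (λ n → subst (λ p → abs p < ε) (sym (p-0≡p (seq x n)))) (null ε 0<ε)

≈0⇒Null : ∀ x → x ≈ᴿ 0ᴿ → Null (seq x)
≈0⇒Null x x≈0 ε 0<ε = Eventually-map (λ n → subst (λ p → abs p < ε) (p-0≡p (seq x n))) (x≈0 ε 0<ε)

Null-resp : ∀ {x y} → (∀ n → x n ≡ y n) → Null x → Null y
Null-resp x≡y null ε 0<ε = Eventually-map (λ n → subst (λ p → abs p < ε) (x≡y n)) (null ε 0<ε)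

Null-+ : ∀ {x y} → Null x → Null y → Null λ n → x n + y n
Null-+ {x} {y} null-x null-y ε 0<ε =
  Eventually-zip (λ n → abs-½ {x n} {y n}) (null-x (½ * ε) (½-pos 0<ε)) (null-y (½ * ε) (½-pos 0<ε))

Null-neg : ∀ {x} → Null x → Null λ n → - x n
Null-neg {x} null ε 0<ε = Eventually-map (λ n → subst (_< ε) (sym (∣-p∣≡∣p∣ (x n)))) (null ε 0<ε)

Null-* : ∀ {x y} → Cauchy x → Null y → Null λ n → x n * y n
Null-* {x} {y} cx null ε 0<ε = bound (Cauchy⇒bounded cx)
  where
  bound : (∃ λ β → 0ℚ < β × Eventually λ n → abs (x n) < β) → Eventually λ n → abs (x n * y n) < ε
  bound (β , 0<β , x<β) = scale (divide 0<β 0<ε)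
    where
    scale : (∃ λ δ → 0ℚ < δ × β * δ ≡ ε) → Eventually λ n → abs (x n * y n) < ε
    scale (δ , 0<δ , βδ≡ε) = Eventually-zip
      (λ n h k → subst (abs (x n * y n) <_) βδ≡ε (abs-* {x n} {y n} {β} {δ} 0<β h k)) x<β (null δ 0<δ)

Null-*-split : ∀ {x y} → Cauchy x → Cauchy y → Null (λ n → x n * y n) → ∀ ε → 0ℚ < ε →
  (Eventually λ n → abs (x n) < ε) ⊎ (Eventually λ n → abs (y n) < ε)
Null-*-split {x} {y} cx cy null ε 0<ε = compare (cx η 0<η) (cy η 0<η) (null (η * η) (*-pos 0<η 0<η))
  where
  open +-*-Solver
  η = ½ * ε
  0<η : 0ℚ < η
  0<η = ½-pos 0<ε

  spread : ∀ {z N K} → (∀ m n → N ℕ.≤ m → N ℕ.≤ n → abs (z m - z n) < η) → N ℕ.≤ K → abs (z K) < η →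
    Eventually λ n → abs (z n) < ε
  spread {z} {N} {K} h N≤K zK<η = N , λ n N≤n → subst (λ p → abs p < ε)
    (solve 2 (λ a b → (a :- b) :+ b := a) refl (z n) (z K))
    (abs-½ {z n - z K} {z K} (h n K N≤n N≤K) zK<η)

  compare : (∃ λ M → ∀ m n → M ℕ.≤ m → M ℕ.≤ n → abs (x m - x n) < η) →
    (∃ λ N → ∀ m n → N ℕ.≤ m → N ℕ.≤ n → abs (y m - y n) < η) → (Eventually λ n → abs (x n * y n) < η * η) →
    (Eventually λ n → abs (x n) < ε) ⊎ (Eventually λ n → abs (y n) < ε)
  compare (M , g) (N , h) (L , k) = decide (abs (x K) <? η) (abs (y K) <? η)
    where
    K = (M ℕ.⊔ N) ℕ.⊔ L
    M⊔N≤K = ℕ.m≤m⊔n (M ℕ.⊔ N) L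
    decide : Dec (abs (x K) < η) → Dec (abs (y K) < η) →
      (Eventually λ n → abs (x n) < ε) ⊎ (Eventually λ n → abs (y n) < ε)
    decide (yes xK<η) _ = inj₁ (spread {x} g (ℕ.m⊔n≤o⇒m≤o M N M⊔N≤K) xK<η)
    decide (no _) (yes yK<η) = inj₂ (spread {y} h (ℕ.m⊔n≤o⇒n≤o M N M⊔N≤K) yK<η)
    decide (no xK≮η) (no yK≮η) = contradiction (k K (ℕ.m≤n⊔m (M ℕ.⊔ N) L)) (λ xy<ηη → <-irrefl refl (begin-strict
      η * η                 ≤⟨ *-monoʳ-≤-nonNeg η {{nonNegative (<⇒≤ 0<η)}} (≮⇒≥ xK≮η) ⟩
      abs (x K) * η         ≤⟨ *-monoˡ-≤-nonNeg (abs (x K)) {{nonNegative (0≤∣p∣ (x K))}} (≮⇒≥ yK≮η) ⟩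
      abs (x K) * abs (y K) ≡⟨ ∣p*q∣≡∣p∣*∣q∣ (x K) (y K) ⟨
      abs (x K * y K)       <⟨ xy<ηη ⟩
      η * η                 ∎))
      where open ≤-Reasoning

Null-*-zero : ExcludedMiddle 0ℓ → ∀ {x y} → Cauchy x → Cauchy y → Null (λ n → x n * y n) → Null x ⊎ Null y
Null-*-zero em {x} {y} cx cy null with em {Null x}
... | yes null-x = inj₁ null-x
... | no ¬null-x = inj₂ null-y
  where
  null-y : Null y
  null-y ε 0<ε with em {Eventually λ n → abs (y n) < ε}
  ... | yes y<ε = y<ε
  ... | no  y≮ε = contradiction null-x ¬null-x
    where
    null-x : Null x
    null-x ε′ 0<ε′ =
      [ Eventually-map (λ n h → <-≤-trans h (p⊓q≤q ε ε′))
      , (λ y<ε⊓ε′ → contradiction (Eventually-map (λ n h → <-≤-trans h (p⊓q≤p ε ε′)) y<ε⊓ε′) y≮ε)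
      ]′ (Null-*-split {x} {y} cx cy null (ε ⊓ ε′) (⊓-pos 0<ε 0<ε′))

<ᴿ-trans : ∀ {x y z} → x <ᴿ y → y <ᴿ z → x <ᴿ z
<ᴿ-trans {x} {y} {z} (δ , 0<δ , x<y) (η , 0<η , y<z) = δ , 0<δ , Eventually-zip step x<y y<z
  where
  open ≤-Reasoning
  step : ∀ n → seq x n + δ ≤ seq y n → seq y n + η ≤ seq z n → seq x n + δ ≤ seq z n
  step n h k = begin
    seq x n + δ  ≤⟨ h ⟩
    seq y n      ≡⟨ +-identityʳ (seq y n) ⟨
    seq y n + 0ℚ ≤⟨ +-monoʳ-≤ (seq y n) (<⇒≤ 0<η) ⟩
    seq y n + η  ≤⟨ k ⟩
    seq z n      ∎

<ᴿ-respʳ-≈ᴿ : ∀ {x y z} → y ≈ᴿ z → x <ᴿ y → x <ᴿ z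
<ᴿ-respʳ-≈ᴿ {x} {y} {z} y≈z (δ , 0<δ , x<y) =
  ½ * δ , ½-pos 0<δ , Eventually-zip step x<y (y≈z (½ * δ) (½-pos 0<δ))
  where
  open +-*-Solver
  open ≤-Reasoning
  η = ½ * δ
  step : ∀ n → seq x n + δ ≤ seq y n → abs (seq y n - seq z n) < ½ * δ → seq x n + ½ * δ ≤ seq z n
  step n h k = begin
    seq x n + η                         ≡⟨ solve 2 (λ a e → a :+ e := (a :+ (e :+ e)) :- e) refl (seq x n) η ⟩
    (seq x n + (η + η)) - η             ≡⟨ cong (λ d → (seq x n + d) - η) (½+½ δ) ⟩
    (seq x n + δ) - η                   ≤⟨ +-monoˡ-≤ (- η) h ⟩
    seq y n - η                         ≡⟨ solve 3 (λ b c e → b :- e := (b :- c) :+ (c :- e)) refl (seq y n) (seq z n) η ⟩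
    (seq y n - seq z n) + (seq z n - η) ≤⟨ +-monoˡ-≤ (seq z n - η) (≤-trans (p≤abs (seq y n - seq z n)) (<⇒≤ k)) ⟩
    η + (seq z n - η)                   ≡⟨ solve 2 (λ c e → e :+ (c :- e) := c) refl (seq z n) η ⟩
    seq z n                             ∎

<ᴿ-irrefl : ∀ {x} → ¬ (x <ᴿ x)
<ᴿ-irrefl {x} (δ , 0<δ , x<x) with Eventually-witness x<x
... | n , h = <-irrefl refl (begin-strict
  seq x n      ≡⟨ +-identityʳ (seq x n) ⟨
  seq x n + 0ℚ <⟨ +-monoʳ-< (seq x n) 0<δ ⟩
  seq x n + δ  ≤⟨ h ⟩
  seq x n      ∎)
  where open ≤-Reasoning

-- Real polynomials are lists of coefficients starting with the constant term.
eval : List ℝ → ℝ → ℝ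
eval []      x = 0ᴿ
eval (a ∷ p) x = a +ᴿ x *ᴿ eval p x

NegativeRoot : List ℝ → ℝ → Set
NegativeRoot p x = x <ᴿ 0ᴿ × eval p x ≈ᴿ 0ᴿ

IsMaximum : (ℝ → Set) → ℝ → Set
IsMaximum Z r = Z r × (∀ s → Z s → s ≤ᴿ r)

root-0⇒constant-0 : ∀ a p → eval (a ∷ p) 0ᴿ ≈ᴿ 0ᴿ → a ≈ᴿ 0ᴿ
root-0⇒constant-0 a p root = Null⇒≈0 a (Null-resp constant (≈0⇒Null (eval (a ∷ p) 0ᴿ) root))
  where
  constant : ∀ n → seq a n + 0ℚ * seq (eval p 0ᴿ) n ≡ seq a n
  constant n = trans (cong (λ d → seq a n + d) (*-zeroˡ (seq (eval p 0ᴿ) n))) (+-identityʳ (seq a n))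

-- The quotient of a ∷ p by X - r; it does not depend on a.
quotient : ℝ → List ℝ → List ℝ
quotient r []      = []
quotient r (b ∷ p) = eval (b ∷ p) r ∷ quotient r p

length-quotient : ∀ r p → length (quotient r p) ≡ length p
length-quotient r []      = refl
length-quotient r (b ∷ p) = cong suc (length-quotient r p)

eval-quotient : ∀ a p r x n →
  seq (eval (a ∷ p) x) n - seq (eval (a ∷ p) r) n ≡ (seq x n - seq r n) * seq (eval (quotient r p) x) n
eval-quotient a [] r x n =
  solve 3 (λ a r x → (a :+ x :* con 0ℚ) :- (a :+ r :* con 0ℚ) := (x :- r) :* con 0ℚ) refl (seq a n) (seq r n) (seq x n)
  where open +-*-Solver
eval-quotient a (b ∷ p) r x n = begin
  (A + X * P) - (A + R * P′)        ≡⟨ solve 5 (λ a r x p p′ →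
      (a :+ x :* p) :- (a :+ r :* p′) := x :* (p :- p′) :+ (x :- r) :* p′) refl A R X P P′ ⟩
  X * (P - P′) + (X - R) * P′       ≡⟨ cong (λ d → X * d + (X - R) * P′) (eval-quotient b p r x n) ⟩
  X * ((X - R) * Q) + (X - R) * P′  ≡⟨ solve 4 (λ r x q p′ →
      x :* ((x :- r) :* q) :+ (x :- r) :* p′ := (x :- r) :* (p′ :+ x :* q)) refl R X Q P′ ⟩
  (X - R) * (P′ + X * Q)            ∎
  where
  open ≡-Reasoning
  open +-*-Solver
  A = seq a n
  R = seq r n
  X = seq x n
  P = seq (eval (b ∷ p) x) n
  P′ = seq (eval (b ∷ p) r) n
  Q = seq (eval (quotient r p) x) n

module _ (a : ℝ) (p : List ℝ) (r : ℝ) (root-r : eval (a ∷ p) r ≈ᴿ 0ᴿ) where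

  quotient-root⇒root : ∀ x → eval (quotient r p) x ≈ᴿ 0ᴿ → eval (a ∷ p) x ≈ᴿ 0ᴿ
  quotient-root⇒root x qx≈0 = Null⇒≈0 (eval (a ∷ p) x) (Null-resp recombine
    (Null-+ {seq ((x -ᴿ r) *ᴿ eval (quotient r p) x)} {seq (eval (a ∷ p) r)}
      (Null-* {seq (x -ᴿ r)} (cauchy (x -ᴿ r)) (≈0⇒Null (eval (quotient r p) x) qx≈0)) (≈0⇒Null (eval (a ∷ p) r) root-r)))
    where
    open +-*-Solver
    recombine : ∀ n → (seq x n - seq r n) * seq (eval (quotient r p) x) n + seq (eval (a ∷ p) r) n ≡ seq (eval (a ∷ p) x) n
    recombine n = trans (cong (_+ seq (eval (a ∷ p) r) n) (sym (eval-quotient a p r x n)))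
      (solve 2 (λ a b → (a :- b) :+ b := a) refl (seq (eval (a ∷ p) x) n) (seq (eval (a ∷ p) r) n))

  root⇒quotient-root : ExcludedMiddle 0ℓ → ∀ x → eval (a ∷ p) x ≈ᴿ 0ᴿ → x ≈ᴿ r ⊎ eval (quotient r p) x ≈ᴿ 0ᴿ
  root⇒quotient-root em x px≈0 = [ inj₁ , (λ qx → inj₂ (Null⇒≈0 Q qx)) ]′
    (Null-*-zero em {seq (x -ᴿ r)} {seq Q} (cauchy (x -ᴿ r)) (cauchy Q)
      (Null-resp {λ n → seq P n - seq R n} {λ n → (seq x n - seq r n) * seq Q n} (eval-quotient a p r x)
        (Null-+ {seq P} {λ n → - seq R n} (≈0⇒Null P px≈0) (Null-neg {seq R} (≈0⇒Null R root-r)))))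
    where
    P = eval (a ∷ p) x
    Q = eval (quotient r p) x
    R = eval (a ∷ p) r

-- A polynomial that does not vanish identically has only finitely many roots, so that
-- its set of negative roots, if nonempty, has a maximum.
abstract

  maximum-negativeRoot : ExcludedMiddle 0ℓ → ∀ n p → length p ≡ n → (∃ λ x → ¬ (eval p x ≈ᴿ 0ᴿ)) →
    ∃ (NegativeRoot p) → ∃ (IsMaximum (NegativeRoot p))
  maximum-negativeRoot em n [] _ (x , px≉0) _ = contradiction (Null⇒≈0 0ᴿ λ ε 0<ε → 0 , λ _ _ → 0<ε) px≉0
  maximum-negativeRoot em (suc n) (a ∷ p) |p|≡n (x , px≉0) (r , r<0 , pr≈0) with em {∃ (NegativeRoot (quotient r p))}
  ... | no none = r , (r<0 , pr≈0) , λ s (s<0 , ps≈0) r<s →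
    [ (λ s≈r → <ᴿ-irrefl {r} (<ᴿ-respʳ-≈ᴿ {r} {s} {r} s≈r r<s))
    , (λ qs≈0 → none (s , s<0 , qs≈0))
    ]′ (root⇒quotient-root a p r pr≈0 em s ps≈0)
  ... | yes some = compare (maximum-negativeRoot em n (quotient r p) (trans (length-quotient r p) (ℕ.suc-injective |p|≡n))
                     (x , λ qx≈0 → px≉0 (quotient-root⇒root a p r pr≈0 x qx≈0)) some)
    where
    choose : ∀ t → NegativeRoot (quotient r p) t → (∀ s → NegativeRoot (quotient r p) s → s ≤ᴿ t) → Dec (t <ᴿ r) →
      ∃ (IsMaximum (NegativeRoot (a ∷ p)))
    choose t (t<0 , qt≈0) greatest (yes t<r) = r , (r<0 , pr≈0) , λ s (s<0 , ps≈0) r<s →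
      [ (λ s≈r → <ᴿ-irrefl {r} (<ᴿ-respʳ-≈ᴿ {r} {s} {r} s≈r r<s))
      , (λ qs≈0 → greatest s (s<0 , qs≈0) (<ᴿ-trans {t} {r} {s} t<r r<s))
      ]′ (root⇒quotient-root a p r pr≈0 em s ps≈0)
    choose t (t<0 , qt≈0) greatest (no t≮r) = t , (t<0 , quotient-root⇒root a p r pr≈0 t qt≈0) , λ s (s<0 , ps≈0) t<s →
      [ (λ s≈r → t≮r (<ᴿ-respʳ-≈ᴿ {t} {s} {r} s≈r t<s))
      , (λ qs≈0 → greatest s (s<0 , qs≈0) t<s)
      ]′ (root⇒quotient-root a p r pr≈0 em s ps≈0)

    compare : ∃ (IsMaximum (NegativeRoot (quotient r p))) → ∃ (IsMaximum (NegativeRoot (a ∷ p)))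
    compare (t , root-t , greatest) = choose t root-t greatest em

-- The maximum of the set of negative roots, or ⊥₋ (that is, -∞) if that set is empty.
largestNegativeRoot : ExcludedMiddle 0ℓ → ∀ p → (∃ λ x → ¬ (eval p x ≈ᴿ 0ᴿ)) → Dec (∃ (NegativeRoot p)) → ℝ ₋
largestNegativeRoot em p nonzero (yes nonempty) = [ proj₁ (maximum-negativeRoot em (length p) p refl nonzero nonempty) ]
largestNegativeRoot em p nonzero (no  _)        = ⊥₋

-- A finite simple graph whose vertices are taken from Fin N; the vertex set V
-- need not be all of Fin N, so that a graph and its subgraphs have the same type.
record Graph (N : ℕ) : Set₁ where
  field
    V         : Subset N
    Adj       : Fin N → Fin N → Set
    adj?      : ∀ u v → Dec (Adj u v)
    symmetric : ∀ {u v} → Adj u v → Adj v u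
    loopless  : ∀ {v} → ¬ Adj v v
    endpoints : ∀ {u v} → Adj u v → u ∈ V × v ∈ V

open Graph public

_InducedSubgraphOf_ : ∀ {N} → Graph N → Graph N → Set
H InducedSubgraphOf G = V H ⊆ V G × (∀ {u v} → u ∈ V H → v ∈ V H → Adj H u v ⇔ Adj G u v)

infix 10 _⟦_⟧

_⟦_⟧ : ∀ {N} → Graph N → Subset N → Graph N
G ⟦ B ⟧ = record
  { V         = V G ∩ B
  ; Adj       = λ u v → Adj G u v × (u ∈ B × v ∈ B)
  ; adj?      = λ u v → adj? G u v ×-dec (u ∈? B ×-dec v ∈? B)
  ; symmetric = λ (uv , u∈B , v∈B) → symmetric G uv , v∈B , u∈B
  ; loopless  = λ (vv , _) → loopless G vv
  ; endpoints = λ (uv , u∈B , v∈B) →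
      x∈p∩q⁺ (proj₁ (endpoints G uv) , u∈B) , x∈p∩q⁺ (proj₂ (endpoints G uv) , v∈B)
  }

IsClique : ∀ {N} → Graph N → Subset N → Set
IsClique G K = K ⊆ V G × (∀ u v → u ∈ K → v ∈ K → u ≢ v → Adj G u v)

isClique? : ∀ {N} (G : Graph N) K → Dec (IsClique G K)
isClique? G K = K ⊆? V G ×-dec
  all? λ u → all? λ v → (u ∈? K) →-dec ((v ∈? K) →-dec (¬? (u ≟ᶠ v) →-dec adj? G u v))

-- Every subset of Fin N, listed exactly once.
subsets : ∀ N → List (Subset N)
subsets zero    = Data.Vec.[] ∷ []
subsets (suc N) = map (inside Data.Vec.∷_) (subsets N) ++ map (outside Data.Vec.∷_) (subsets N)

ω : ∀ {N} → Graph N → ℕ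
ω {N} G = foldr ℕ._⊔_ 0 (map ∣_∣ (filter (isClique? G) (subsets N)))

cliqueCount : ∀ {N} → Graph N → Subset N → ℕ → ℕ
cliqueCount {N} G B i =
  length (filter (λ K → K ⊆? B ×-dec (∣ K ∣ ℕ.≟ i ×-dec isClique? G K)) (subsets N))

cliquePolynomial : ∀ {N} → Graph N → Subset N → List ℝ
cliquePolynomial G B = map (λ i → fromℕ (cliqueCount G B i)) (upTo (suc (ω (G ⟦ B ⟧))))

Z : ∀ {N} → Graph N → Subset N → ℝ → Set
Z G B = NegativeRoot (cliquePolynomial G B)

⊥∈subsets : ∀ N → ⊥ ∈ˡ subsets N
⊥∈subsets zero    = here refl
⊥∈subsets (suc N) = ∈-++⁺ʳ (map (inside Data.Vec.∷_) (subsets N)) (∈-map⁺ (outside Data.Vec.∷_) (⊥∈subsets N))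

cliqueCount-0 : ∀ {N} (G : Graph N) B → cliqueCount G B 0 ≢ 0
cliqueCount-0 {N} G B eq = nonempty eq (∈-filter⁺ (λ K → K ⊆? B ×-dec (∣ K ∣ ℕ.≟ 0 ×-dec isClique? G K)) (⊥∈subsets N)
  ((λ u∈⊥ → contradiction u∈⊥ ∉⊥) , ∣⊥∣≡0 N , (λ u∈⊥ → contradiction u∈⊥ ∉⊥) , λ u v u∈⊥ → contradiction u∈⊥ ∉⊥))
  where
  nonempty : ∀ {K} {Ks : List (Subset N)} → length Ks ≡ 0 → ¬ (K ∈ˡ Ks)
  nonempty {Ks = []} _ ()

fromℚ-≉0 : ∀ {q} → 0ℚ < q → ¬ (fromℚ q ≈ᴿ 0ᴿ)
fromℚ-≉0 {q} 0<q q≈0 = <-irrefl refl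
  (≤-<-trans (p≤abs q) (proj₂ (Eventually-witness (≈0⇒Null (fromℚ q) q≈0 q 0<q))))

fromℕ-≉0 : ∀ k → k ≢ 0 → ¬ (fromℕ k ≈ᴿ 0ᴿ)
fromℕ-≉0 zero    k≢0 _ = k≢0 refl
fromℕ-≉0 (suc k) _     = fromℚ-≉0 (positive⁻¹ (+ suc k ÷ 1) {{normalize-pos (suc k) 1}})

cliquePolynomial-nonzero : ∀ {N} (G : Graph N) B → ∃ λ x → ¬ (eval (cliquePolynomial G B) x ≈ᴿ 0ᴿ)
cliquePolynomial-nonzero G B = 0ᴿ , λ p0≈0 → fromℕ-≉0 (cliqueCount G B 0) (cliqueCount-0 G B)
  (root-0⇒constant-0 (fromℕ (cliqueCount G B 0))
    (map (λ i → fromℕ (cliqueCount G B i)) (applyUpTo suc (ω (G ⟦ B ⟧)))) p0≈0)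

-- Excluded middle decides whether Z G B is empty. When B ⊈ V G, the vertices of B
-- outside V G are ignored.
ζ : ExcludedMiddle 0ℓ → ∀ {N} → Graph N → Subset N → ℝ ₋
ζ em G B = largestNegativeRoot em (cliquePolynomial G B) (cliquePolynomial-nonzero G B) (em {∃ (Z G B)})

{-# OPTIONS --safe #-}

-- A clique contained in B ⊆ V H is a clique of H exactly when it is one of G, so both
-- graphs have the same B-restricted clique polynomial, and a maximal root for H is a
-- root for G.
module Submission where

open import Defs
open import Axiom.ExcludedMiddle using (ExcludedMiddle)
open import Data.Fin.Subset using (Subset; _⊆_; ∣_∣)
open import Data.Fin.Subset.Properties using (⊆-trans; p∩q⊆q; x∈p∩q⁺; x∈p∩q⁻)
open import Data.List using (length; foldr; map; upTo)
open import Data.List.Properties using (filter-≐; map-cong)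
open import Data.Nat using (ℕ; suc; _⊔_)
open import Data.Product using (_,_; proj₁; proj₂)
open import Function using (_⇔_; mk⇔; Equivalence)
open import Level using (0ℓ)
open import Relation.Binary.PropositionalEquality using (_≡_; refl; cong; trans; subst)
open import Relation.Nullary using (yes; no; contradiction)
open import Relation.Binary.Construct.Add.Infimum.NonStrict _≤ᴿ_ using (⊥₋≤_; [_])

open Equivalence

-- The polynomial sees only cliques inside `B`, and these are the same in both graphs. Coefficients
-- agree by `cliqueCount-induced` and degrees by `ω-induced`, so the coefficient lists are equal;
-- `largestNegativeRoot-mono` turns this into the inequality.

module _ {N : ℕ} {G H : Graph N} (H⊑G : H InducedSubgraphOf G) where

  isClique-induced : ∀ {K} → K ⊆ V H → IsClique H K ⇔ IsClique G K
  isClique-induced K⊆H = mk⇔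
    (λ (_ , adj) → ⊆-trans K⊆H (proj₁ H⊑G) , λ u v u∈K v∈K u≢v →
      to (proj₂ H⊑G (K⊆H u∈K) (K⊆H v∈K)) (adj u v u∈K v∈K u≢v))
    (λ (_ , adj) → K⊆H , λ u v u∈K v∈K u≢v →
      from (proj₂ H⊑G (K⊆H u∈K) (K⊆H v∈K)) (adj u v u∈K v∈K u≢v))

  -- The degree is `ω` of the graphs cut down to `B`; this lets `isClique-induced` apply to them
  -- too.
  restrict-induced : ∀ B → (H ⟦ B ⟧) InducedSubgraphOf (G ⟦ B ⟧)
  restrict-induced B =
    (λ u∈H∩B → let u∈H , u∈B = x∈p∩q⁻ (V H) B u∈H∩B in x∈p∩q⁺ (proj₁ H⊑G u∈H , u∈B)) ,
    λ u∈ v∈ → let u⇔v = proj₂ H⊑G (proj₁ (x∈p∩q⁻ (V H) B u∈)) (proj₁ (x∈p∩q⁻ (V H) B v∈)) in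
      mk⇔ (λ (uv , uv∈B) → to u⇔v uv , uv∈B) (λ (uv , uv∈B) → from u⇔v uv , uv∈B)

module _ {N : ℕ} {G H : Graph N} (H⊑G : H InducedSubgraphOf G) {B : Subset N} (B⊆H : B ⊆ V H) where

  cliqueCount-induced : ∀ i → cliqueCount H B i ≡ cliqueCount G B i
  cliqueCount-induced i = cong length (filter-≐ _ _
    ( (λ (K⊆B , size , clique) → K⊆B , size , to (same K⊆B) clique)
    , (λ (K⊆B , size , clique) → K⊆B , size , from (same K⊆B) clique))
    (subsets N))
    where
    same : ∀ {K} → K ⊆ B → IsClique H K ⇔ IsClique G K
    same K⊆B = isClique-induced {G = G} {H} H⊑G (⊆-trans K⊆B B⊆H)

  ω-induced : ω (H ⟦ B ⟧) ≡ ω (G ⟦ B ⟧)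
  ω-induced = cong (λ Ks → foldr _⊔_ 0 (map ∣_∣ Ks)) (filter-≐ (isClique? (H ⟦ B ⟧)) (isClique? (G ⟦ B ⟧))
    ( (λ clique → to (same (proj₁ clique)) clique)
    -- A clique of `G ⟦ B ⟧` is only known to lie in `V G ∩ B`; `B ⊆ V H` moves it into `V H ∩ B`.
    , (λ clique → from (same (λ u∈K →
        let u∈B = p∩q⊆q (V G) B (proj₁ clique u∈K) in x∈p∩q⁺ (B⊆H u∈B , u∈B))) clique))
    (subsets N))
    where
    same : ∀ {K} → K ⊆ V (H ⟦ B ⟧) → IsClique (H ⟦ B ⟧) K ⇔ IsClique (G ⟦ B ⟧) K
    same = isClique-induced {G = G ⟦ B ⟧} {H ⟦ B ⟧} (restrict-induced {G = G} {H} H⊑G B)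

  cliquePolynomial-induced : cliquePolynomial H B ≡ cliquePolynomial G B
  cliquePolynomial-induced = trans
    (map-cong (λ i → cong fromℕ (cliqueCount-induced i)) (upTo (suc (ω (H ⟦ B ⟧)))))
    (cong (λ n → map (λ i → fromℕ (cliqueCount G B i)) (upTo (suc n))) ω-induced)

-- A maximum can only grow with its set, and an empty set gives `⊥₋`. Asking only for inclusion of
-- roots lets the nonvanishing proofs and the decisions differ on the two sides.
largestNegativeRoot-mono : ∀ (em : ExcludedMiddle 0ℓ) {p q} nonzero-p nonzero-q dec-p dec-q →
  (∀ {x} → NegativeRoot p x → NegativeRoot q x) →
  largestNegativeRoot em p nonzero-p dec-p ≤₋ largestNegativeRoot em q nonzero-q dec-q
largestNegativeRoot-mono em _ _ (no _) _ _ = ⊥₋≤ _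
largestNegativeRoot-mono em _ _ (yes (x , root)) (no none) p⇒q = contradiction (x , p⇒q root) none
largestNegativeRoot-mono em nonzero-p nonzero-q (yes some-p) (yes some-q) p⇒q =
  [ proj₂ (proj₂ (maximum-negativeRoot em _ _ refl nonzero-q some-q)) _
      (p⇒q (proj₁ (proj₂ (maximum-negativeRoot em _ _ refl nonzero-p some-p)))) ]

theorem2p5 : (em : ExcludedMiddle 0ℓ) →
    ∀ {N : ℕ} (G H : Graph N) → H InducedSubgraphOf G →
    ∀ (B : Subset N) → B ⊆ V H →
    ζ em H B ≤₋ ζ em G B
theorem2p5 em G H H⊑G B B⊆H = largestNegativeRoot-mono em
  (cliquePolynomial-nonzero H B) (cliquePolynomial-nonzero G B) em em
  (λ {x} → subst (λ p → NegativeRoot p x) (cliquePolynomial-induced {G = G} {H} H⊑G B⊆H))
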